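{- Every plain dependent type theory $(\mathbf{ctx},u,\dot u,\Sigma\dashv\Delta)$ contains the rules of type and term dependency: (DTy) from $\Gamma\vdash a:A$ and $\Gamma.A\vdash B$ type, deduce $\Gamma\vdash B[a]$ type; (DTm) from $\Gamma\vdash a:A$ and $\Gamma.A\vdash b:B$, deduce $\Gamma\vdash b[a]:B[a]$. In detail, let $\eta'=\dot u\ast\eta:\dot u\Rightarrow\dot u\Delta\Sigma$ be the whiskering of the unit $\eta$ of $\Sigma\dashv\Delta$. The $\sharp$-liftings of $\eta'$ along $u$ and along $\dot u$ give functors in the theory $$u^*\mathrm{id}:\dot{\mathcal U}.\Sigma\Delta\mathcal U\to\dot{\mathcal U}\times_{\mathbf{ctx}}\mathcal U,\quad (a,B)\mapsto(a,B[a]),\qquad \dot u^*\mathrm{id}:\dot{\mathcal U}.\Sigma\Delta\dot{\mathcal U}\to\dot{\mathcal U}\times_{\mathbf{ctx}}\dot{\mathcal U},\quad (a,b)\mapsto(a,b[a]),$$ and policies $u^*\eta'$, $\dot u^*\eta'$ in the theory whose components are the cartesian lifts $B[a]\to B$ and $b[a]\to b$ of $\eta'_a:\Gamma\to\Gamma.A$, where $\Gamma=\dot u(a)$, $A=\Sigma a$, $\Gamma.A=\dot u\Delta A$. The typing is the appropriate one: if $\Sigma b=B$ then $\Sigma(b[a])=B[a]$. Moreover the premise can be re-based over $\Gamma$: let $v:\mathcal U.\Delta\mathcal U\to\mathbf{ctx}$ be $(A,B)\mapsto u(A)$. Pasting $u^*\eta'$ with the policy $\delta=u\ast\epsilon:\dot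 u\Delta\Rightarrow u$ gives a policy, from the composite of $u^*\mathrm{id}$ with the projection $\dot{\mathcal U}\times_{\mathbf{ctx}}\mathcal U\to\mathbf{ctx}$ to the composite $\dot{\mathcal U}.\Sigma\Delta\mathcal U\to\mathcal U.\Delta\mathcal U\xrightarrow{v}\mathbf{ctx}$, where the first functor is $(a,B)\mapsto(\Sigma a,B)$; this policy is (DTy), with both premise $(a,B)$ and conclusion lying over $\Gamma$. A similar argument for terms gives (DTm).
   Context: Plain dependent type theory: a category $\mathbf{ctx}$ (with terminal object), fibrations (with given cleavages) $u:\mathcal U\to\mathbf{ctx}$ (types) and $\dot u:\dot{\mathcal U}\to\mathbf{ctx}$ (terms), a functor $\Sigma:\dot{\mathcal U}\to\mathcal U$ (typing) with $u\Sigma=\dot u$, and a right adjoint $\Delta:\mathcal U\to\dot{\mathcal U}$ of $\Sigma$ (not required to commute with the functors to $\mathbf{ctx}$), with unit $\eta$ and counit $\epsilon$, such that $\Sigma$ and $\Delta$ preserve cartesian morphisms and the components of $\eta$ and $\epsilon$ are cartesian; formally it is the judgemental theory generated by these data. Notation for judgements: "$\Gamma\vdash A$ type" means $A\in\mathcal U$ with $u(A)=\Gamma$; "$\Gamma\vdash a:A$" means $a\in\dot{\mathcal U}$ with $\dot u(a)=\Gamma$ and $\Sigma a=A$ (equality of objects of $\mathcal U$). $\mathcal U.\Delta\mathcal U$ is the pullback of $\dot u\Delta:\mathcal U\to\mathbf{ctx}$ and $u$ (objects: pairs $(A,B)$ with $u(B)=\dot u\Delta A$). $\dot{\mathcal U}.\Sigma\Delta\mathcal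 U$ is the pullback of $\dot u\Delta\Sigma:\dot{\mathcal U}\to\mathbf{ctx}$ and $u$ (objects: pairs $(a,B)$ with $u(B)=\dot u\Delta\Sigma a$). $\dot{\mathcal U}.\Sigma\Delta\dot{\mathcal U}$ is the pullback of $\dot u\Delta\Sigma$ and $\dot u$ (objects: pairs $(a,b)$ with $\dot u(b)=\dot u\Delta\Sigma a$). Judgemental theory: a category $\mathbf{ctx}$ with terminal object, a set $\mathscr R$ of functors ("rules"), of which those with codomain $\mathbf{ctx}$ are the "judgement classifiers", and a set $\mathscr P$ of natural transformations ("policies") filling triangles of rules, such that $\mathscr R,\mathscr P$ are closed under composition, finite limits (pullbacks, equalizers, finite powers, with projections and functors induced by cones of rules), whiskering and $\sharp$-liftings. $\sharp$-lifting: given rules $\lambda:\mathcal F\to\mathcal G$, $r:\mathcal F\to\mathcal X$, $r':\mathcal G\to\mathcal X$, a policy $\lambda^\sharp:r'\lambda\Rightarrow r$ and a rule $h:\mathcal H\to\mathcal X$ which is a fibration, the $\sharp$-lifting of $\lambda^\sharp$ along $h$ consists of the functor $h^*\lambda:\mathcal F\times_{\mathcal X}\mathcal H\to\mathcal G\times_{\mathcal X}\mathcal H$, $(F,H)\mapsto(\lambda F,H[\lambda^\sharp_F])$ (reindexing along $\lambda^\sharp_F$), and the natural transformation $h^*\lambda^\sharp$ whose components are the cartesian lifts $H[\lambda^\sharp_F]\to H$; both are required to be in the theory (and dually for opfibrations). Here $\lambda=\mathrm{id}_{\dot{\mathcal U}}$, $r=\dot u\Delta\Sigma$, $r'=\dot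 u$, $\lambda^\sharp=\eta'$. The theory generated by given functors and natural transformations is the smallest one containing them.
   Formalization: The equality Σ(b[a]) = B[a], hence strict Γ ⊢ b[a] : B[a], fails for unrelated cleavages; it is proved when Σ sends chosen lifts to chosen lifts. In general Σ(b[a]) is shown to be a reindexing of B along η'_a, isomorphic to B[a] over Γ. -}

module Defs where

open import Level using (Level; _⊔_) renaming (suc to lsuc)
open import Data.Nat.Base using (ℕ; zero; suc)
open import Data.Fin.Base using (Fin; zero; suc)
open import Data.Product using (∃; ∃₂; ∃!; _×_; _,_; proj₁; proj₂)
open import Data.Unit.Polymorphic.Base using (⊤; tt)
open import Relation.Binary.PropositionalEquality.Core
  using (_≡_; refl; sym; trans; cong; cong₂; subst₂)
open import Relation.Binary.HeterogeneousEquality.Core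
  using (_≅_; refl; ≅-to-≡; ≡-to-≅)
import Relation.Binary.HeterogeneousEquality as ≅

private
  variable
    o h ℓ : Level

-- Pullbacks of categories and statements such as u(A) = Γ are strict: they
-- refer to equality of objects.  Categories therefore have sets of objects
-- and of morphisms (axiom K is in force), and morphisms whose endpoints agree
-- only propositionally are compared by heterogeneous equality _≅_.
--
-- Categories, functors and transformations have no eta equality, so that the
-- operations on them below do not unfold and their arguments can be inferred.

record Category (o h : Level) : Set (lsuc (o ⊔ h)) where
  no-eta-equality
  infixr 9 _∘_
  field
    Obj       : Set o
    _⇒_       : Obj → Obj → Set h
    id        : ∀ {a} → a ⇒ a
    _∘_       : ∀ {a b c} → b ⇒ c → a ⇒ b → a ⇒ c
    identityˡ : ∀ {a b} {f : a ⇒ b} → id ∘ f ≡ f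
    identityʳ : ∀ {a b} {f : a ⇒ b} → f ∘ id ≡ f
    assoc     : ∀ {a b c d} {f : a ⇒ b} {g : b ⇒ c} {k : c ⇒ d} →
                (k ∘ g) ∘ f ≡ k ∘ (g ∘ f)

open Category using (Obj)

infix 10 _[_,_] _[_∘_]

_[_,_] : (C : Category o h) → Obj C → Obj C → Set h
C [ a , b ] = Category._⇒_ C a b

_[_∘_] : (C : Category o h) {a b c : Obj C} →
         C [ b , c ] → C [ a , b ] → C [ a , c ]
C [ g ∘ f ] = Category._∘_ C g f

id[_] : (C : Category o h) {a : Obj C} → C [ a , a ]
id[ C ] = Category.id C

module _ (C : Category o h) where
  open Category C

  ∘-cong≅ : ∀ {a a′ b b′ c c′} {g : b ⇒ c} {g′ : b′ ⇒ c′} {f : a ⇒ b} {f′ : a′ ⇒ b′} →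
            a ≡ a′ → b ≡ b′ → c ≡ c′ → g ≅ g′ → f ≅ f′ → (g ∘ f) ≅ (g′ ∘ f′)
  ∘-cong≅ refl refl refl refl refl = refl

  id-cong≅ : ∀ {a a′} → a ≡ a′ → id {a} ≅ id {a′}
  id-cong≅ refl = refl

  coerce : ∀ {a a′ b b′} → a ≡ a′ → b ≡ b′ → a ⇒ b → a′ ⇒ b′
  coerce = subst₂ _⇒_

  coerce-≅ : ∀ {a a′ b b′} (p : a ≡ a′) (q : b ≡ b′) (f : a ⇒ b) → coerce p q f ≅ f
  coerce-≅ refl refl f = refl

record Functor (C D : Category o h) : Set (o ⊔ h) where
  no-eta-equality
  private
    module C = Category C
    module D = Category D
  field
    F₀           : Obj C → Obj D
    F₁           : ∀ {a b} → C [ a , b ] → D [ F₀ a , F₀ b ]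
    identity     : ∀ {a} → F₁ (C.id {a}) ≡ D.id
    homomorphism : ∀ {a b c} {f : C [ a , b ]} {g : C [ b , c ]} →
                   F₁ (g C.∘ f) ≡ F₁ g D.∘ F₁ f

open Functor public using (F₀; F₁)

idF : {C : Category o h} → Functor C C
idF .F₀ a                 = a
idF .F₁ f                 = f
idF .Functor.identity     = refl
idF .Functor.homomorphism = refl

infixr 9 _∘F_

_∘F_ : {A B C : Category o h} → Functor B C → Functor A B → Functor A C
(G ∘F F) .F₀ a                 = F₀ G (F₀ F a)
(G ∘F F) .F₁ f                 = F₁ G (F₁ F f)
(G ∘F F) .Functor.identity     = trans (cong (F₁ G) (Functor.identity F)) (Functor.identity G)
(G ∘F F) .Functor.homomorphism =
  trans (cong (F₁ G) (Functor.homomorphism F)) (Functor.homomorphism G)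

infix 4 _≈F_

record _≈F_ {C D : Category o h} (F G : Functor C D) : Set (o ⊔ h) where
  field
    eq₀ : ∀ a → F₀ F a ≡ F₀ G a
    eq₁ : ∀ {a b} (f : C [ a , b ]) → F₁ F f ≅ F₁ G f

open _≈F_ public

record NatTrans {C D : Category o h} (F G : Functor C D) : Set (o ⊔ h) where
  no-eta-equality
  field
    η       : ∀ a → D [ F₀ F a , F₀ G a ]
    natural : ∀ {a b} (f : C [ a , b ]) → D [ η b ∘ F₁ F f ] ≡ D [ F₁ G f ∘ η a ]

open NatTrans public using (η)

record _≈N_ {C D : Category o h} {F G F′ G′ : Functor C D}
            (α : NatTrans F G) (β : NatTrans F′ G′) : Set (o ⊔ h) where
  field
    source     : F ≈F F′
    target     : G ≈F G′
    components : ∀ a → η α a ≅ η β a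

idN : {C D : Category o h} {F : Functor C D} → NatTrans F F
idN {D = D} .η _               = Category.id D
idN {D = D} .NatTrans.natural _ =
  trans (Category.identityˡ D) (sym (Category.identityʳ D))

infixr 9 _∘N_

_∘N_ : {C D : Category o h} {F G H : Functor C D} →
       NatTrans G H → NatTrans F G → NatTrans F H
_∘N_ {D = D} β α .η a               = D [ η β a ∘ η α a ]
_∘N_ {D = D} β α .NatTrans.natural f =
  trans assoc (trans (cong (η β _ ∘_) (NatTrans.natural α f))
  (trans (sym assoc) (trans (cong (_∘ η α _) (NatTrans.natural β f)) assoc)))
  where open Category D

infixr 10 _∘ˡ_ _∘ʳ_

_∘ˡ_ : {A B C : Category o h} {F G : Functor A B} (K : Functor B C) →
       NatTrans F G → NatTrans (K ∘F F) (K ∘F G)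
(K ∘ˡ α) .η a               = F₁ K (η α a)
(K ∘ˡ α) .NatTrans.natural f =
  trans (sym (Functor.homomorphism K))
  (trans (cong (F₁ K) (NatTrans.natural α f)) (Functor.homomorphism K))

_∘ʳ_ : {A B C : Category o h} {F G : Functor B C} →
       NatTrans F G → (K : Functor A B) → NatTrans (F ∘F K) (G ∘F K)
(α ∘ʳ K) .η a               = η α (F₀ K a)
(α ∘ʳ K) .NatTrans.natural f = NatTrans.natural α (F₁ K f)

recast : {C D : Category o h} {F G F′ G′ : Functor C D} →
         F ≈F F′ → G ≈F G′ → NatTrans F G → NatTrans F′ G′
recast {D = D} p q α .η a = coerce D (eq₀ p a) (eq₀ q a) (η α a)
recast {D = D} p q α .NatTrans.natural {a} {b} f = ≅-to-≡ (≅.trans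
  (∘-cong≅ D (sym (eq₀ p a)) (sym (eq₀ p b)) (sym (eq₀ q b)) (comp≅ b) (≅.sym (eq₁ p f)))
  (≅.trans (≡-to-≅ (NatTrans.natural α f))
  (∘-cong≅ D (eq₀ p a) (eq₀ q a) (eq₀ q b) (eq₁ q f) (≅.sym (comp≅ a)))))
  where
  comp≅ : ∀ a → coerce D (eq₀ p a) (eq₀ q a) (η α a) ≅ η α a
  comp≅ a = coerce-≅ D (eq₀ p a) (eq₀ q a) (η α a)

≈F-refl : {C D : Category o h} {F : Functor C D} → F ≈F F
≈F-refl = record { eq₀ = λ _ → refl ; eq₁ = λ _ → refl }

≈F-sym : {C D : Category o h} {F G : Functor C D} → F ≈F G → G ≈F F
≈F-sym p = record { eq₀ = λ a → sym (eq₀ p a) ; eq₁ = λ f → ≅.sym (eq₁ p f) }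

∘F-assoc : {A B C D : Category o h} {H : Functor C D} {G : Functor B C} {F : Functor A B} →
           (H ∘F (G ∘F F)) ≈F ((H ∘F G) ∘F F)
∘F-assoc = record { eq₀ = λ _ → refl ; eq₁ = λ _ → refl }

op : Category o h → Category o h
op C .Obj                = Obj C
op C .Category._⇒_ a b   = C [ b , a ]
op C .Category.id        = Category.id C
op C .Category._∘_ g f   = C [ f ∘ g ]
op C .Category.identityˡ = Category.identityʳ C
op C .Category.identityʳ = Category.identityˡ C
op C .Category.assoc     = sym (Category.assoc C)

opF : {C D : Category o h} → Functor C D → Functor (op C) (op D)
opF F .F₀                   = F₀ F
opF F .F₁                   = F₁ F
opF F .Functor.identity     = Functor.identity F
opF F .Functor.homomorphism = Functor.homomorphism F

record Terminal (C : Category o h) : Set (o ⊔ h) where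
  field
    ⋆        : Obj C
    !        : ∀ a → C [ a , ⋆ ]
    !-unique : ∀ {a} (f : C [ a , ⋆ ]) → ! a ≡ f

record _⊣_ {C D : Category o h} (L : Functor C D) (R : Functor D C) : Set (o ⊔ h) where
  field
    unit   : NatTrans idF (R ∘F L)
    counit : NatTrans (L ∘F R) idF
    zig    : ∀ a → D [ η counit (F₀ L a) ∘ F₁ L (η unit a) ] ≡ id[ D ]
    zag    : ∀ b → C [ F₁ R (η counit b) ∘ η unit (F₀ R b) ] ≡ id[ C ]

module _ {A B X : Category o h} (F : Functor A X) (G : Functor B X) where
  private
    module A = Category A
    module B = Category B

  Pullback-Obj : Set o
  Pullback-Obj = ∃₂ λ a b → F₀ F a ≡ F₀ G b

  record Pullback-Hom (x y : Pullback-Obj) : Set h where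
    constructor mkHom
    field
      left     : A [ proj₁ x , proj₁ y ]
      right    : B [ proj₁ (proj₂ x) , proj₁ (proj₂ y) ]
      commutes : F₁ F left ≅ F₁ G right

  open Pullback-Hom

  Pullback-≡ : ∀ {x y} {m n : Pullback-Hom x y} →
               left m ≡ left n → right m ≡ right n → m ≡ n
  Pullback-≡ {m = mkHom f g p} {mkHom .f .g q} refl refl =
    cong (mkHom f g) (≅.≅-irrelevant p q)

  Pullback : Category o h
  Pullback .Obj = Pullback-Obj
  Pullback .Category._⇒_ = Pullback-Hom
  Pullback .Category.id {_ , _ , p} = mkHom A.id B.id
    (≅.trans (≡-to-≅ (Functor.identity F))
    (≅.trans (id-cong≅ X p) (≡-to-≅ (sym (Functor.identity G)))))
  Pullback .Category._∘_ {_ , _ , p} {_ , _ , q} {_ , _ , r} n m =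
    mkHom (left n A.∘ left m) (right n B.∘ right m)
    (≅.trans (≡-to-≅ (Functor.homomorphism F))
    (≅.trans (∘-cong≅ X p q r (commutes n) (commutes m))
             (≡-to-≅ (sym (Functor.homomorphism G)))))
  Pullback .Category.identityˡ = Pullback-≡ A.identityˡ B.identityˡ
  Pullback .Category.identityʳ = Pullback-≡ A.identityʳ B.identityʳ
  Pullback .Category.assoc     = Pullback-≡ A.assoc B.assoc

open Pullback-Hom public

module _ {A B X : Category o h} {F : Functor A X} {G : Functor B X} where

  π₁ : Functor (Pullback F G) A
  π₁ .F₀                   = proj₁
  π₁ .F₁                   = left
  π₁ .Functor.identity     = refl
  π₁ .Functor.homomorphism = refl

  π₂ : Functor (Pullback F G) B
  π₂ .F₀ x                 = proj₁ (proj₂ x)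
  π₂ .F₁                   = right
  π₂ .Functor.identity     = refl
  π₂ .Functor.homomorphism = refl

pullback-pair : {A B X Z : Category o h} (F : Functor A X) (G : Functor B X)
                (P : Functor Z A) (Q : Functor Z B) →
                (F ∘F P) ≈F (G ∘F Q) → Functor Z (Pullback F G)
pullback-pair F G P Q e .F₀ z                 = F₀ P z , F₀ Q z , eq₀ e z
pullback-pair F G P Q e .F₁ f                 = mkHom (F₁ P f) (F₁ Q f) (eq₁ e f)
pullback-pair F G P Q e .Functor.identity     =
  Pullback-≡ F G (Functor.identity P) (Functor.identity Q)
pullback-pair F G P Q e .Functor.homomorphism =
  Pullback-≡ F G (Functor.homomorphism P) (Functor.homomorphism Q)

module _ {A B : Category o h} (F G : Functor A B) where
  private
    module A = Category A

  Equalizer-Obj : Set o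
  Equalizer-Obj = ∃ λ a → F₀ F a ≡ F₀ G a

  record Equalizer-Hom (x y : Equalizer-Obj) : Set h where
    constructor mkHom
    field
      arrow     : A [ proj₁ x , proj₁ y ]
      equalizes : F₁ F arrow ≅ F₁ G arrow

  open Equalizer-Hom

  Equalizer-≡ : ∀ {x y} {m n : Equalizer-Hom x y} → arrow m ≡ arrow n → m ≡ n
  Equalizer-≡ {m = mkHom f p} {mkHom .f q} refl = cong (mkHom f) (≅.≅-irrelevant p q)

  Equalizer : Category o h
  Equalizer .Obj = Equalizer-Obj
  Equalizer .Category._⇒_ = Equalizer-Hom
  Equalizer .Category.id {_ , p} = mkHom A.id
    (≅.trans (≡-to-≅ (Functor.identity F))
    (≅.trans (id-cong≅ B p) (≡-to-≅ (sym (Functor.identity G)))))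
  Equalizer .Category._∘_ {_ , p} {_ , q} {_ , r} n m = mkHom (arrow n A.∘ arrow m)
    (≅.trans (≡-to-≅ (Functor.homomorphism F))
    (≅.trans (∘-cong≅ B p q r (equalizes n) (equalizes m))
             (≡-to-≅ (sym (Functor.homomorphism G)))))
  Equalizer .Category.identityˡ = Equalizer-≡ A.identityˡ
  Equalizer .Category.identityʳ = Equalizer-≡ A.identityʳ
  Equalizer .Category.assoc     = Equalizer-≡ A.assoc

  equalizer : Functor Equalizer A
  equalizer .F₀                   = proj₁
  equalizer .F₁                   = arrow
  equalizer .Functor.identity     = refl
  equalizer .Functor.homomorphism = refl

  equalize : {Z : Category o h} (P : Functor Z A) → (F ∘F P) ≈F (G ∘F P) → Functor Z Equalizer
  equalize P e .F₀ z                 = F₀ P z , eq₀ e z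
  equalize P e .F₁ f                 = mkHom (F₁ P f) (eq₁ e f)
  equalize P e .Functor.identity     = Equalizer-≡ (Functor.identity P)
  equalize P e .Functor.homomorphism = Equalizer-≡ (Functor.homomorphism P)

One : Category o h
One .Obj                = ⊤
One .Category._⇒_ _ _   = ⊤
One .Category.id        = tt
One .Category._∘_ _ _   = tt
One .Category.identityˡ = refl
One .Category.identityʳ = refl
One .Category.assoc     = refl

infixr 2 _×C_

_×C_ : Category o h → Category o h → Category o h
(C ×C D) .Obj                        = Obj C × Obj D
(C ×C D) .Category._⇒_ (a , b) (c , d) = C [ a , c ] × D [ b , d ]
(C ×C D) .Category.id                = id[ C ] , id[ D ]
(C ×C D) .Category._∘_ (k , l) (f , g) = C [ k ∘ f ] , D [ l ∘ g ]
(C ×C D) .Category.identityˡ         = cong₂ _,_ (Category.identityˡ C) (Category.identityˡ D)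
(C ×C D) .Category.identityʳ         = cong₂ _,_ (Category.identityʳ C) (Category.identityʳ D)
(C ×C D) .Category.assoc             = cong₂ _,_ (Category.assoc C) (Category.assoc D)

Power : Category o h → ℕ → Category o h
Power C zero    = One
Power C (suc n) = C ×C Power C n

project : {C : Category o h} (n : ℕ) → Fin n → Functor (Power C n) C
project (suc n) zero .F₀                      = proj₁
project (suc n) zero .F₁                      = proj₁
project (suc n) zero .Functor.identity        = refl
project (suc n) zero .Functor.homomorphism    = refl
project (suc n) (suc i) .F₀ x                 = F₀ (project n i) (proj₂ x)
project (suc n) (suc i) .F₁ f                 = F₁ (project n i) (proj₂ f)
project (suc n) (suc i) .Functor.identity     = Functor.identity (project n i)
project (suc n) (suc i) .Functor.homomorphism = Functor.homomorphism (project n i)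

tuple : {Z C : Category o h} (n : ℕ) → (Fin n → Functor Z C) → Functor Z (Power C n)
tuple zero    P .F₀ _                 = tt
tuple zero    P .F₁ _                 = tt
tuple zero    P .Functor.identity     = refl
tuple zero    P .Functor.homomorphism = refl
tuple (suc n) P .F₀ z                 = F₀ (P zero) z , F₀ (tuple n (λ i → P (suc i))) z
tuple (suc n) P .F₁ f                 = F₁ (P zero) f , F₁ (tuple n (λ i → P (suc i))) f
tuple (suc n) P .Functor.identity     =
  cong₂ _,_ (Functor.identity (P zero)) (Functor.identity (tuple n (λ i → P (suc i))))
tuple (suc n) P .Functor.homomorphism =
  cong₂ _,_ (Functor.homomorphism (P zero)) (Functor.homomorphism (tuple n (λ i → P (suc i))))

module _ {E B : Category o h} (p : Functor E B) where

  IsCartesian : {d e : Obj E} → E [ d , e ] → Set (o ⊔ h)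
  IsCartesian {d} {e} φ =
    ∀ {c} (g : E [ c , e ]) (w : B [ F₀ p c , F₀ p d ]) →
    B [ F₁ p φ ∘ w ] ≡ F₁ p g →
    ∃! _≡_ λ (m : E [ c , d ]) → E [ φ ∘ m ] ≡ g × F₁ p m ≡ w

  -- "φ is a cartesian lift of f", where f need not have p d and p e as its
  -- definitional endpoints.
  record IsCartesianLift {x y : Obj B} (f : B [ x , y ])
                         {d e : Obj E} (φ : E [ d , e ]) : Set (o ⊔ h) where
    field
      dom-over  : F₀ p d ≡ x
      cod-over  : F₀ p e ≡ y
      over      : F₁ p φ ≅ f
      cartesian : IsCartesian φ

  record CartesianLift {x y : Obj B} (f : B [ x , y ]) (e : Obj E) : Set (o ⊔ h) where
    field
      dom    : Obj E
      mor    : E [ dom , e ]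
      isLift : IsCartesianLift f mor
    open IsCartesianLift isLift public

  -- A fibration is a functor with a cleavage; cleavages are neither split
  -- nor normal.
  Cleavage : Set (o ⊔ h)
  Cleavage = ∀ {x y} (f : B [ x , y ]) (e : Obj E) → F₀ p e ≡ y → CartesianLift f e

  module _ {x y : Obj B} {f : B [ x , y ]} {d e : Obj E} {φ : E [ d , e ]}
           (l : IsCartesianLift f φ) where
    open IsCartesianLift

    factor : ∀ {c z} (w : B [ z , x ]) (g : E [ c , e ]) → F₀ p c ≡ z →
             F₁ p g ≅ B [ f ∘ w ] →
             ∃ λ (m : E [ c , d ]) → E [ φ ∘ m ] ≡ g × F₁ p m ≅ w
    factor w g refl eq with dom-over l | cod-over l | over l
    ... | refl | refl | refl with cartesian l g w (sym (≅-to-≡ eq))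
    ... | m , (t , s) , _ = m , t , ≡-to-≅ s

    factor-unique : ∀ {c} {m m′ : E [ c , d ]} →
                    E [ φ ∘ m ] ≡ E [ φ ∘ m′ ] → F₁ p m ≡ F₁ p m′ → m ≡ m′
    factor-unique {m = m} {m′} t s
      with cartesian l (E [ φ ∘ m′ ]) (F₁ p m′) (sym (Functor.homomorphism p))
    ... | _ , _ , u = trans (sym (u (t , s))) (u (refl , refl))

Opcleavage : {E B : Category o h} → Functor E B → Set (o ⊔ h)
Opcleavage p = Cleavage (opF p)

module _ {A B X H : Category o h}
         (l : Functor A B) (r : Functor A X) (r′ : Functor B X)
         (l♯ : NatTrans (r′ ∘F l) r)
         (k : Functor H X) (cl : Cleavage k) where
  private
    open CartesianLift
    module H = Category H
    P = Pullback r k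

    lift : (x : Obj P) → CartesianLift k (η l♯ (proj₁ x)) (proj₁ (proj₂ x))
    lift (a , y , p) = cl (η l♯ a) y (sym p)

    act : ∀ {x x′} (m : P [ x , x′ ]) →
          ∃ λ (n : H [ dom (lift x) , dom (lift x′) ]) →
            H [ mor (lift x′) ∘ n ] ≡ H [ right m ∘ mor (lift x) ] ×
            F₁ k n ≅ F₁ r′ (F₁ l (left m))
    act {x@(_ , _ , p)} {x′@(_ , _ , p′)} m =
      factor k (isLift (lift x′)) (F₁ r′ (F₁ l (left m))) (H [ right m ∘ mor (lift x) ])
        (dom-over (lift x))
        (≅.trans (≡-to-≅ (Functor.homomorphism k))
        (≅.trans (∘-cong≅ X (dom-over (lift x)) (sym p) (sym p′)
                            (≅.sym (commutes m)) (over (lift x)))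
                 (≡-to-≅ (sym (NatTrans.natural l♯ (left m))))))

    act₁ : ∀ {x x′} → P [ x , x′ ] → H [ dom (lift x) , dom (lift x′) ]
    act₁ m = proj₁ (act m)

    act-comm : ∀ {x x′} (m : P [ x , x′ ]) →
               H [ mor (lift x′) ∘ act₁ m ] ≡ H [ right m ∘ mor (lift x) ]
    act-comm m = proj₁ (proj₂ (act m))

    act-over : ∀ {x x′} (m : P [ x , x′ ]) → F₁ k (act₁ m) ≅ F₁ r′ (F₁ l (left m))
    act-over m = proj₂ (proj₂ (act m))

    act-id : ∀ {x} → act₁ (id[ P ] {x}) ≡ H.id
    act-id {x} = factor-unique k (isLift (lift x))
      (trans (act-comm (id[ P ] {x})) (trans H.identityˡ (sym H.identityʳ)))
      (≅-to-≡ (≅.trans (act-over (id[ P ] {x}))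
        (≅.trans (≡-to-≅ (Functor.identity (r′ ∘F l)))
        (≅.trans (id-cong≅ X (sym (dom-over (lift x))))
                 (≡-to-≅ (sym (Functor.identity k)))))))

    act-∘ : ∀ {x y z} (m : P [ x , y ]) (n : P [ y , z ]) →
            act₁ (P [ n ∘ m ]) ≡ H [ act₁ n ∘ act₁ m ]
    act-∘ {x} {y} {z} m n = factor-unique k (isLift (lift z))
      (trans (act-comm (P [ n ∘ m ]))
        (trans H.assoc
        (trans (cong (right n H.∘_) (sym (act-comm m)))
        (trans (sym H.assoc)
        (trans (cong (H._∘ act₁ m) (sym (act-comm n))) H.assoc)))))
      (≅-to-≡ (≅.trans (act-over (P [ n ∘ m ]))
        (≅.trans (≡-to-≅ (Functor.homomorphism (r′ ∘F l)))
        (≅.trans (∘-cong≅ X (sym (dom-over (lift x))) (sym (dom-over (lift y)))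
                    (sym (dom-over (lift z)))
                    (≅.sym (act-over n)) (≅.sym (act-over m)))
                 (≡-to-≅ (sym (Functor.homomorphism k)))))))

  -- (a , y) ↦ (l a , y[l♯ₐ])
  ♯-functor : Functor (Pullback r k) (Pullback r′ k)
  ♯-functor .F₀ x = F₀ l (proj₁ x) , dom (lift x) , sym (dom-over (lift x))
  ♯-functor .F₁ m = mkHom (F₁ l (left m)) (act₁ m) (≅.sym (act-over m))
  ♯-functor .Functor.identity = Pullback-≡ r′ k (Functor.identity l) act-id
  ♯-functor .Functor.homomorphism {f = m} {n} =
    Pullback-≡ r′ k (Functor.homomorphism l) (act-∘ m n)

  ♯-nat : NatTrans (π₂ {F = r′} {k} ∘F ♯-functor) (π₂ {F = r} {k})
  ♯-nat .η x               = mor (lift x)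
  ♯-nat .NatTrans.natural m = act-comm m

-- The dual for an opfibration k, obtained by passing to opposite categories:
-- (a , y) ↦ (l a , (l♯ₐ)₊ y), the components being the opcartesian lifts.

module _ {A B X H : Category o h}
         (l : Functor A B) (r : Functor A X) (r′ : Functor B X)
         (l♯ : NatTrans r (r′ ∘F l))
         (k : Functor H X) (cl : Opcleavage k) where
  private
    P  = Pullback r k
    Pᵒ = Pullback (opF r) (opF k)

    l♯ᵒ : NatTrans (opF r′ ∘F opF l) (opF r)
    l♯ᵒ .η               = η l♯
    l♯ᵒ .NatTrans.natural f = sym (NatTrans.natural l♯ f)

    L = ♯-functor (opF l) (opF r) (opF r′) l♯ᵒ (opF k) cl
    α = ♯-nat (opF l) (opF r) (opF r′) l♯ᵒ (opF k) cl

    to-op : ∀ {x y} → P [ x , y ] → Pᵒ [ y , x ]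
    to-op m = mkHom (left m) (right m) (commutes m)

    L-id : ∀ {x} → F₁ L (to-op (id[ P ] {x})) ≡ id[ Pullback (opF r′) (opF k) ]
    L-id = trans (cong (F₁ L) (Pullback-≡ (opF r) (opF k) refl refl)) (Functor.identity L)

    L-∘ : ∀ {x y z} (m : P [ x , y ]) (n : P [ y , z ]) →
          F₁ L (to-op (P [ n ∘ m ])) ≡
          Pullback (opF r′) (opF k) [ F₁ L (to-op m) ∘ F₁ L (to-op n) ]
    L-∘ m n = trans (cong (F₁ L) (Pullback-≡ (opF r) (opF k) refl refl))
                    (Functor.homomorphism L)

  ♯ᵒ-functor : Functor (Pullback r k) (Pullback r′ k)
  ♯ᵒ-functor .F₀ = F₀ L
  ♯ᵒ-functor .F₁ m =
    let n = F₁ L (to-op m) in mkHom (left n) (right n) (commutes n)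
  ♯ᵒ-functor .Functor.identity {x} =
    Pullback-≡ r′ k (cong left (L-id {x})) (cong right (L-id {x}))
  ♯ᵒ-functor .Functor.homomorphism {f = m} {n} =
    Pullback-≡ r′ k (cong left (L-∘ m n)) (cong right (L-∘ m n))

  ♯ᵒ-nat : NatTrans (π₂ {F = r} {k}) (π₂ {F = r′} {k} ∘F ♯ᵒ-functor)
  ♯ᵒ-nat .η               = η α
  ♯ᵒ-nat .NatTrans.natural m = sym (NatTrans.natural α (to-op m))

-- The rules with codomain ctx are the judgement classifiers.  Functors and
-- transformations that agree extensionally are identified (rule-resp,
-- policy-resp).  Closure under composition includes the empty composites on
-- the categories and functors of the theory.  A power requires only that its
-- base occur in the theory, i.e. that the identity on it be a rule.
-- ♯-liftings are taken along every rule that is a fibration, for every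
-- cleavage of it; ♯ᵒ-liftings likewise for opfibrations.

record JudgementalTheory (ctx : Category o h) (ℓ : Level) : Set (lsuc (o ⊔ h ⊔ ℓ)) where
  field
    terminal      : Terminal ctx
    Rule          : {C D : Category o h} → Functor C D → Set ℓ
    Policy        : {C D : Category o h} {F G : Functor C D} → NatTrans F G → Set ℓ
    policy-source : ∀ {C D : Category o h} {F G : Functor C D} {α : NatTrans F G} →
                    Policy α → Rule F
    policy-target : ∀ {C D : Category o h} {F G : Functor C D} {α : NatTrans F G} →
                    Policy α → Rule G
    rule-resp     : ∀ {C D : Category o h} {F G : Functor C D} → F ≈F G → Rule F → Rule G
    policy-resp   : ∀ {C D : Category o h} {F G F′ G′ : Functor C D}
                    {α : NatTrans F G} {β : NatTrans F′ G′} → α ≈N β → Policy α → Policy β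

    id-ctx        : Rule (idF {C = ctx})
    id-dom        : ∀ {C D : Category o h} {F : Functor C D} → Rule F → Rule (idF {C = C})
    id-cod        : ∀ {C D : Category o h} {F : Functor C D} → Rule F → Rule (idF {C = D})
    _∘-rule_      : ∀ {A B C : Category o h} {G : Functor B C} {F : Functor A B} →
                    Rule G → Rule F → Rule (G ∘F F)
    id-policy     : ∀ {C D : Category o h} {F : Functor C D} → Rule F → Policy (idN {F = F})
    _∘-policy_    : ∀ {C D : Category o h} {F G H : Functor C D}
                    {β : NatTrans G H} {α : NatTrans F G} →
                    Policy β → Policy α → Policy (β ∘N α)
    whiskerˡ      : ∀ {A B C : Category o h} {F G : Functor A B} {α : NatTrans F G}
                    {K : Functor B C} → Rule K → Policy α → Policy (K ∘ˡ α)
    whiskerʳ      : ∀ {A B C : Category o h} {F G : Functor B C} {α : NatTrans F G}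
                    {K : Functor A B} → Policy α → Rule K → Policy (α ∘ʳ K)

    pullback-π₁   : ∀ {A B X : Category o h} {F : Functor A X} {G : Functor B X} →
                    Rule F → Rule G → Rule (π₁ {F = F} {G})
    pullback-π₂   : ∀ {A B X : Category o h} {F : Functor A X} {G : Functor B X} →
                    Rule F → Rule G → Rule (π₂ {F = F} {G})
    pullback-cone : ∀ {A B X Z : Category o h} {F : Functor A X} {G : Functor B X}
                    {P : Functor Z A} {Q : Functor Z B} →
                    Rule F → Rule G → Rule P → Rule Q →
                    (e : (F ∘F P) ≈F (G ∘F Q)) → Rule (pullback-pair F G P Q e)
    equalizer-map : ∀ {A B : Category o h} {F G : Functor A B} →
                    Rule F → Rule G → Rule (equalizer F G)
    equalizer-cone : ∀ {A B Z : Category o h} {F G : Functor A B} {P : Functor Z A} →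
                    Rule F → Rule G → Rule P →
                    (e : (F ∘F P) ≈F (G ∘F P)) → Rule (equalize F G P e)
    power-project : ∀ {C : Category o h} → Rule (idF {C = C}) →
                    ∀ n i → Rule (project {C = C} n i)
    power-cone    : ∀ {Z C : Category o h} → Rule (idF {C = Z}) → Rule (idF {C = C}) →
                    ∀ n (P : Fin n → Functor Z C) → (∀ i → Rule (P i)) → Rule (tuple n P)

    ♯-rule        : ∀ {A B X H : Category o h} {l : Functor A B} {r : Functor A X}
                    {r′ : Functor B X} {l♯ : NatTrans (r′ ∘F l) r} {k : Functor H X} →
                    Rule l → Rule r → Rule r′ → Policy l♯ → Rule k → (cl : Cleavage k) →
                    Rule (♯-functor l r r′ l♯ k cl)
    ♯-policy      : ∀ {A B X H : Category o h} {l : Functor A B} {r : Functor A X}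
                    {r′ : Functor B X} {l♯ : NatTrans (r′ ∘F l) r} {k : Functor H X} →
                    Rule l → Rule r → Rule r′ → Policy l♯ → Rule k → (cl : Cleavage k) →
                    Policy (♯-nat l r r′ l♯ k cl)
    ♯ᵒ-rule       : ∀ {A B X H : Category o h} {l : Functor A B} {r : Functor A X}
                    {r′ : Functor B X} {l♯ : NatTrans r (r′ ∘F l)} {k : Functor H X} →
                    Rule l → Rule r → Rule r′ → Policy l♯ → Rule k → (cl : Opcleavage k) →
                    Rule (♯ᵒ-functor l r r′ l♯ k cl)
    ♯ᵒ-policy     : ∀ {A B X H : Category o h} {l : Functor A B} {r : Functor A X}
                    {r′ : Functor B X} {l♯ : NatTrans r (r′ ∘F l)} {k : Functor H X} →
                    Rule l → Rule r → Rule r′ → Policy l♯ → Rule k → (cl : Opcleavage k) →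
                    Policy (♯ᵒ-nat l r r′ l♯ k cl)

record PlainDTT (o h : Level) : Set (lsuc (o ⊔ h)) where
  field
    ctx        : Category o h
    terminal   : Terminal ctx
    U U̇        : Category o h
    u          : Functor U ctx
    u̇          : Functor U̇ ctx
    u-cleavage : Cleavage u
    u̇-cleavage : Cleavage u̇
    Σ          : Functor U̇ U
    uΣ≈u̇       : (u ∘F Σ) ≈F u̇
    Δ          : Functor U U̇
    Σ⊣Δ        : Σ ⊣ Δ

  open _⊣_ Σ⊣Δ public

  field
    Σ-cartesian      : ∀ {a b} {f : U̇ [ a , b ]} → IsCartesian u̇ f → IsCartesian u (F₁ Σ f)
    Δ-cartesian      : ∀ {A B} {f : U [ A , B ]} → IsCartesian u f → IsCartesian u̇ (F₁ Δ f)
    unit-cartesian   : ∀ a → IsCartesian u̇ (η unit a)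
    counit-cartesian : ∀ A → IsCartesian u (η counit A)

module Generated (D : PlainDTT o h) where
  open PlainDTT D

  data Rule   : {C D : Category o h} → Functor C D → Set (lsuc (o ⊔ h))
  data Policy : {C D : Category o h} {F G : Functor C D} → NatTrans F G → Set (lsuc (o ⊔ h))

  data Rule where
    u-rule        : Rule u
    u̇-rule        : Rule u̇
    Σ-rule        : Rule Σ
    Δ-rule        : Rule Δ
    rule-resp     : ∀ {C D : Category o h} {F G : Functor C D} → F ≈F G → Rule F → Rule G
    id-ctx        : Rule (idF {C = ctx})
    id-dom        : ∀ {C D : Category o h} {F : Functor C D} → Rule F → Rule (idF {C = C})
    id-cod        : ∀ {C D : Category o h} {F : Functor C D} → Rule F → Rule (idF {C = D})
    _∘-rule_      : ∀ {A B C : Category o h} {G : Functor B C} {F : Functor A B} →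
                    Rule G → Rule F → Rule (G ∘F F)
    pullback-π₁   : ∀ {A B X : Category o h} {F : Functor A X} {G : Functor B X} →
                    Rule F → Rule G → Rule (π₁ {F = F} {G})
    pullback-π₂   : ∀ {A B X : Category o h} {F : Functor A X} {G : Functor B X} →
                    Rule F → Rule G → Rule (π₂ {F = F} {G})
    pullback-cone : ∀ {A B X Z : Category o h} {F : Functor A X} {G : Functor B X}
                    {P : Functor Z A} {Q : Functor Z B} →
                    Rule F → Rule G → Rule P → Rule Q →
                    (e : (F ∘F P) ≈F (G ∘F Q)) → Rule (pullback-pair F G P Q e)
    equalizer-map : ∀ {A B : Category o h} {F G : Functor A B} →
                    Rule F → Rule G → Rule (equalizer F G)
    equalizer-cone : ∀ {A B Z : Category o h} {F G : Functor A B} {P : Functor Z A} →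
                    Rule F → Rule G → Rule P →
                    (e : (F ∘F P) ≈F (G ∘F P)) → Rule (equalize F G P e)
    power-project : ∀ {C : Category o h} → Rule (idF {C = C}) →
                    ∀ n i → Rule (project {C = C} n i)
    power-cone    : ∀ {Z C : Category o h} → Rule (idF {C = Z}) → Rule (idF {C = C}) →
                    ∀ n (P : Fin n → Functor Z C) → (∀ i → Rule (P i)) → Rule (tuple n P)
    ♯-rule        : ∀ {A B X H : Category o h} {l : Functor A B} {r : Functor A X}
                    {r′ : Functor B X} {l♯ : NatTrans (r′ ∘F l) r} {k : Functor H X} →
                    Rule l → Rule r → Rule r′ → Policy l♯ → Rule k → (cl : Cleavage k) →
                    Rule (♯-functor l r r′ l♯ k cl)
    ♯ᵒ-rule       : ∀ {A B X H : Category o h} {l : Functor A B} {r : Functor A X}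
                    {r′ : Functor B X} {l♯ : NatTrans r (r′ ∘F l)} {k : Functor H X} →
                    Rule l → Rule r → Rule r′ → Policy l♯ → Rule k → (cl : Opcleavage k) →
                    Rule (♯ᵒ-functor l r r′ l♯ k cl)

  data Policy where
    unit-policy   : Policy unit
    counit-policy : Policy counit
    policy-resp   : ∀ {C D : Category o h} {F G F′ G′ : Functor C D}
                    {α : NatTrans F G} {β : NatTrans F′ G′} → α ≈N β → Policy α → Policy β
    id-policy     : ∀ {C D : Category o h} {F : Functor C D} → Rule F → Policy (idN {F = F})
    _∘-policy_    : ∀ {C D : Category o h} {F G H : Functor C D}
                    {β : NatTrans G H} {α : NatTrans F G} →
                    Policy β → Policy α → Policy (β ∘N α)
    whiskerˡ      : ∀ {A B C : Category o h} {F G : Functor A B} {α : NatTrans F G}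
                    {K : Functor B C} → Rule K → Policy α → Policy (K ∘ˡ α)
    whiskerʳ      : ∀ {A B C : Category o h} {F G : Functor B C} {α : NatTrans F G}
                    {K : Functor A B} → Policy α → Rule K → Policy (α ∘ʳ K)
    ♯-policy      : ∀ {A B X H : Category o h} {l : Functor A B} {r : Functor A X}
                    {r′ : Functor B X} {l♯ : NatTrans (r′ ∘F l) r} {k : Functor H X} →
                    Rule l → Rule r → Rule r′ → Policy l♯ → Rule k → (cl : Cleavage k) →
                    Policy (♯-nat l r r′ l♯ k cl)
    ♯ᵒ-policy     : ∀ {A B X H : Category o h} {l : Functor A B} {r : Functor A X}
                    {r′ : Functor B X} {l♯ : NatTrans r (r′ ∘F l)} {k : Functor H X} →
                    Rule l → Rule r → Rule r′ → Policy l♯ → Rule k → (cl : Opcleavage k) →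
                    Policy (♯ᵒ-nat l r r′ l♯ k cl)

  policy-source : ∀ {C D : Category o h} {F G : Functor C D} {α : NatTrans F G} → Policy α → Rule F
  policy-target : ∀ {C D : Category o h} {F G : Functor C D} {α : NatTrans F G} → Policy α → Rule G

  policy-source unit-policy              = id-dom Σ-rule
  policy-source counit-policy            = Σ-rule ∘-rule Δ-rule
  policy-source (policy-resp e p)        = rule-resp (_≈N_.source e) (policy-source p)
  policy-source (id-policy r)            = r
  policy-source (q ∘-policy p)           = policy-source p
  policy-source (whiskerˡ K p)           = K ∘-rule policy-source p
  policy-source (whiskerʳ p K)           = policy-source p ∘-rule K
  policy-source (♯-policy l r r′ p k cl) = pullback-π₂ r′ k ∘-rule ♯-rule l r r′ p k cl
  policy-source (♯ᵒ-policy l r r′ p k cl) = pullback-π₂ r k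

  policy-target unit-policy              = Δ-rule ∘-rule Σ-rule
  policy-target counit-policy            = id-dom Δ-rule
  policy-target (policy-resp e p)        = rule-resp (_≈N_.target e) (policy-target p)
  policy-target (id-policy r)            = r
  policy-target (q ∘-policy p)           = policy-target q
  policy-target (whiskerˡ K p)           = K ∘-rule policy-target p
  policy-target (whiskerʳ p K)           = policy-target p ∘-rule K
  policy-target (♯-policy l r r′ p k cl) = pullback-π₂ r k
  policy-target (♯ᵒ-policy l r r′ p k cl) = pullback-π₂ r′ k ∘-rule ♯ᵒ-rule l r r′ p k cl

  theory : JudgementalTheory ctx (lsuc (o ⊔ h))
  theory = record
    { terminal = terminal ; Rule = Rule ; Policy = Policy
    ; policy-source = policy-source ; policy-target = policy-target
    ; rule-resp = rule-resp
    ; policy-resp = policy-resp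
    ; id-ctx = id-ctx
    ; id-dom = id-dom
    ; id-cod = id-cod
    ; _∘-rule_ = _∘-rule_
    ; id-policy = id-policy
    ; _∘-policy_ = _∘-policy_
    ; whiskerˡ = whiskerˡ
    ; whiskerʳ = whiskerʳ
    ; pullback-π₁ = pullback-π₁
    ; pullback-π₂ = pullback-π₂
    ; pullback-cone = pullback-cone
    ; equalizer-map = equalizer-map
    ; equalizer-cone = equalizer-cone
    ; power-project = power-project
    ; power-cone = power-cone
    ; ♯-rule = ♯-rule
    ; ♯-policy = ♯-policy
    ; ♯ᵒ-rule = ♯ᵒ-rule
    ; ♯ᵒ-policy = ♯ᵒ-policy
    }

  module _ {ℓ} (T : JudgementalTheory ctx ℓ) where
    private
      module T = JudgementalTheory T

    module Least (Tu : T.Rule u) (Tu̇ : T.Rule u̇) (TΣ : T.Rule Σ) (TΔ : T.Rule Δ)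
                 (Tunit : T.Policy unit) (Tcounit : T.Policy counit) where

      rule-least   : ∀ {C D : Category o h} {F : Functor C D} → Rule F → T.Rule F
      policy-least : ∀ {C D : Category o h} {F G : Functor C D} {α : NatTrans F G} →
                     Policy α → T.Policy α

      rule-least u-rule = Tu
      rule-least u̇-rule = Tu̇
      rule-least Σ-rule = TΣ
      rule-least Δ-rule = TΔ
      rule-least (rule-resp e r) = T.rule-resp e (rule-least r)
      rule-least id-ctx = T.id-ctx
      rule-least (id-dom r) = T.id-dom (rule-least r)
      rule-least (id-cod r) = T.id-cod (rule-least r)
      rule-least (s ∘-rule r) = rule-least s T.∘-rule rule-least r
      rule-least (pullback-π₁ f g) = T.pullback-π₁ (rule-least f) (rule-least g)
      rule-least (pullback-π₂ f g) = T.pullback-π₂ (rule-least f) (rule-least g)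
      rule-least (pullback-cone f g p q e) =
        T.pullback-cone (rule-least f) (rule-least g) (rule-least p) (rule-least q) e
      rule-least (equalizer-map f g) = T.equalizer-map (rule-least f) (rule-least g)
      rule-least (equalizer-cone f g p e) =
        T.equalizer-cone (rule-least f) (rule-least g) (rule-least p) e
      rule-least (power-project c n i) = T.power-project (rule-least c) n i
      rule-least (power-cone z c n P ps) =
        T.power-cone (rule-least z) (rule-least c) n P (λ i → rule-least (ps i))
      rule-least (♯-rule l r r′ p k cl) =
        T.♯-rule (rule-least l) (rule-least r) (rule-least r′) (policy-least p) (rule-least k) cl
      rule-least (♯ᵒ-rule l r r′ p k cl) =
        T.♯ᵒ-rule (rule-least l) (rule-least r) (rule-least r′) (policy-least p) (rule-least k) cl

      policy-least unit-policy = Tunit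
      policy-least counit-policy = Tcounit
      policy-least (policy-resp e p) = T.policy-resp e (policy-least p)
      policy-least (id-policy r) = T.id-policy (rule-least r)
      policy-least (q ∘-policy p) = policy-least q T.∘-policy policy-least p
      policy-least (whiskerˡ K p) = T.whiskerˡ (rule-least K) (policy-least p)
      policy-least (whiskerʳ p K) = T.whiskerʳ (policy-least p) (rule-least K)
      policy-least (♯-policy l r r′ p k cl) =
        T.♯-policy (rule-least l) (rule-least r) (rule-least r′) (policy-least p) (rule-least k) cl
      policy-least (♯ᵒ-policy l r r′ p k cl) =
        T.♯ᵒ-policy (rule-least l) (rule-least r) (rule-least r′) (policy-least p) (rule-least k) cl

module Dependency (D : PlainDTT o h) where
  open PlainDTT D

  infix 4 _⊢_type _⊢_∶_

  _⊢_type : Obj ctx → Obj U → Set o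
  Γ ⊢ A type = F₀ u A ≡ Γ

  _⊢_∶_ : Obj ctx → Obj U̇ → Obj U → Set o
  Γ ⊢ a ∶ A = F₀ u̇ a ≡ Γ × F₀ Σ a ≡ A

  -- For Γ ⊢ A type, the object ext A is the extended context Γ.A.
  ext : Obj U → Obj ctx
  ext A = F₀ (u̇ ∘F Δ) A

  η′ : NatTrans (u̇ ∘F idF) (u̇ ∘F (Δ ∘F Σ))
  η′ = u̇ ∘ˡ unit

  δ : NatTrans (u̇ ∘F Δ) u
  δ = recast (record { eq₀ = λ A → eq₀ uΣ≈u̇ (F₀ Δ A) ; eq₁ = λ f → eq₁ uΣ≈u̇ (F₁ Δ f) })
             (record { eq₀ = λ _ → refl ; eq₁ = λ _ → refl })
             (u ∘ˡ counit)

  U̇×U U̇×U̇ U·ΔU U·ΔU̇ U̇·ΣΔU U̇·ΣΔU̇ : Category o h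
  U̇×U    = Pullback u̇ u
  U̇×U̇    = Pullback u̇ u̇
  U·ΔU   = Pullback (u̇ ∘F Δ) u
  U·ΔU̇   = Pullback (u̇ ∘F Δ) u̇
  U̇·ΣΔU  = Pullback (u̇ ∘F (Δ ∘F Σ)) u
  U̇·ΣΔU̇  = Pullback (u̇ ∘F (Δ ∘F Σ)) u̇

  u*id : Functor U̇·ΣΔU U̇×U
  u*id = ♯-functor idF (u̇ ∘F (Δ ∘F Σ)) u̇ η′ u u-cleavage

  u*η′ : NatTrans (π₂ ∘F u*id) π₂
  u*η′ = ♯-nat idF (u̇ ∘F (Δ ∘F Σ)) u̇ η′ u u-cleavage

  u̇*id : Functor U̇·ΣΔU̇ U̇×U̇
  u̇*id = ♯-functor idF (u̇ ∘F (Δ ∘F Σ)) u̇ η′ u̇ u̇-cleavage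

  u̇*η′ : NatTrans (π₂ ∘F u̇*id) π₂
  u̇*η′ = ♯-nat idF (u̇ ∘F (Δ ∘F Σ)) u̇ η′ u̇ u̇-cleavage

  -- The projections of the two fibre products to ctx, computed through the
  -- conclusion B[a], respectively b[a].
  proj-U̇×U : Functor U̇×U ctx
  proj-U̇×U = u ∘F π₂

  proj-U̇×U̇ : Functor U̇×U̇ ctx
  proj-U̇×U̇ = u̇ ∘F π₂

  v : Functor U·ΔU ctx
  v = u ∘F π₁

  v̇ : Functor U·ΔU̇ ctx
  v̇ = u ∘F π₁

  square : ((u̇ ∘F Δ) ∘F (Σ ∘F π₁)) ≈F (u ∘F π₂ {F = u̇ ∘F (Δ ∘F Σ)} {u})
  square = record { eq₀ = λ (_ , _ , p) → p ; eq₁ = commutes }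

  square˙ : ((u̇ ∘F Δ) ∘F (Σ ∘F π₁)) ≈F (u̇ ∘F π₂ {F = u̇ ∘F (Δ ∘F Σ)} {u̇})
  square˙ = record { eq₀ = λ (_ , _ , p) → p ; eq₁ = commutes }

  Σ·ΔU : Functor U̇·ΣΔU U·ΔU
  Σ·ΔU = pullback-pair (u̇ ∘F Δ) u (Σ ∘F π₁) π₂ square

  Σ·ΔU̇ : Functor U̇·ΣΔU̇ U·ΔU̇
  Σ·ΔU̇ = pullback-pair (u̇ ∘F Δ) u̇ (Σ ∘F π₁) π₂ square˙

  -- The pasting of u*η′ with δ; its component at (a , B) is the composite
  --   u(B[a]) → u(B) = u̇ΔΣ(a) → uΣ(a).
  DTy : NatTrans (proj-U̇×U ∘F u*id) (v ∘F Σ·ΔU)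
  DTy = recast ≈F-refl (record { eq₀ = λ _ → refl ; eq₁ = λ _ → refl })
    ((δ ∘ʳ (Σ ∘F π₁)) ∘N recast ∘F-assoc (≈F-sym square) (u ∘ˡ u*η′))

  -- Likewise u̇(b[a]) → u̇(b) = u̇ΔΣ(a) → uΣ(a).
  DTm : NatTrans (proj-U̇×U̇ ∘F u̇*id) (v̇ ∘F Σ·ΔU̇)
  DTm = recast ≈F-refl (record { eq₀ = λ _ → refl ; eq₁ = λ _ → refl })
    ((δ ∘ʳ (Σ ∘F π₁)) ∘N recast ∘F-assoc (≈F-sym square˙) (u̇ ∘ˡ u̇*η′))

  ty-premise : ∀ {Γ a A B} → Γ ⊢ a ∶ A → ext A ⊢ B type → Obj U̇·ΣΔU
  ty-premise {a = a} {B = B} (_ , Σa≡A) uB≡ΓA = a , B , trans (cong ext Σa≡A) (sym uB≡ΓA)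

  tm-premise : ∀ {Γ a A b B} → Γ ⊢ a ∶ A → ext A ⊢ b ∶ B → Obj U̇·ΣΔU̇
  tm-premise {a = a} {b = b} (_ , Σa≡A) (u̇b≡ΓA , _) = a , b , trans (cong ext Σa≡A) (sym u̇b≡ΓA)

  -- The chosen cartesian lifts B[a] → B and b[a] → b of η′ at a.
  ty-lift : ∀ {Γ a A B} → Γ ⊢ a ∶ A → ext A ⊢ B type → CartesianLift u (η η′ a) B
  ty-lift ⊢a ⊢B = let a , B , p = ty-premise ⊢a ⊢B in u-cleavage (η η′ a) B (sym p)

  tm-lift : ∀ {Γ a A b B} → Γ ⊢ a ∶ A → ext A ⊢ b ∶ B → CartesianLift u̇ (η η′ a) b
  tm-lift ⊢a ⊢b = let a , b , p = tm-premise ⊢a ⊢b in u̇-cleavage (η η′ a) b (sym p)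

  infix 9 _[_]ᵗʸ _[_]ᵗᵐ

  _[_]ᵗʸ : ∀ {Γ a A B} → ext A ⊢ B type → Γ ⊢ a ∶ A → Obj U
  ⊢B [ ⊢a ]ᵗʸ = CartesianLift.dom (ty-lift ⊢a ⊢B)

  _[_]ᵗᵐ : ∀ {Γ a A b B} → ext A ⊢ b ∶ B → Γ ⊢ a ∶ A → Obj U̇
  ⊢b [ ⊢a ]ᵗᵐ = CartesianLift.dom (tm-lift ⊢a ⊢b)

  ⊢-type : ∀ {Γ b B} → Γ ⊢ b ∶ B → Γ ⊢ B type
  ⊢-type {b = b} (u̇b≡Γ , Σb≡B) =
    trans (cong (F₀ u) (sym Σb≡B)) (trans (eq₀ uΣ≈u̇ b) u̇b≡Γ)

  -- The functor Σ need not send the chosen lifts of u̇ to those of u, only to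
  -- cartesian lifts.  So Σ (b[a]) and B[a] are both reindexings of B along
  -- η′ at a, but they need not be equal objects: take U̇ = U the codiscrete
  -- category on two objects over the terminal category, Σ and Δ identities,
  -- and for u and u̇ the two constant cleavages.  They are equal if the
  -- cleavages correspond under Σ.
  Σ-PreservesCleavage : Set (o ⊔ h)
  Σ-PreservesCleavage =
    ∀ {x y} (f : ctx [ x , y ]) b (p : F₀ u̇ b ≡ y) (q : F₀ u (F₀ Σ b) ≡ y) →
    let ℓb = u̇-cleavage f b p
        ℓB = u-cleavage f (F₀ Σ b) q
    in F₀ Σ (CartesianLift.dom ℓb) ≡ CartesianLift.dom ℓB ×
       F₁ Σ (CartesianLift.mor ℓb) ≅ CartesianLift.mor ℓB

{-# OPTIONS --safe #-}
module Submission where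

-- The dependency rules are the ♯-liftings of η′.  Since uΣ = u̇ and Σ preserves
-- cartesian morphisms, Σ carries the chosen lift b[a] → b to a cartesian lift
-- of η′ at a with codomain B; two cartesian lifts of one arrow to one object
-- are uniquely isomorphic over the identity, which compares Σ (b[a]) with B[a].

open import Data.Product using (_×_; ∃; ∃₂; _,_; proj₁; proj₂)
open import Relation.Binary.PropositionalEquality using (_≡_; refl; sym; trans; cong)
open import Relation.Binary.HeterogeneousEquality using (_≅_; ≡-to-≅; ≅-to-≡)
import Relation.Binary.HeterogeneousEquality as ≅
open import Defs
open Category using (Obj)

-- `recast` changes a transformation only along equalities of its endpoints, so its components stay
-- heterogeneously equal to the old ones and extensional closure applies.
recast-policy : ∀ {o h ℓ} {ctx : Category o h} (T : JudgementalTheory ctx ℓ) →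
                let open JudgementalTheory T in
                ∀ {C D : Category o h} {F G F′ G′ : Functor C D} {α : NatTrans F G}
                (p : F ≈F F′) (q : G ≈F G′) → Policy α → Policy (recast p q α)
recast-policy T {D = D} {α = α} p q = JudgementalTheory.policy-resp T (record
  { source     = p
  ; target     = q
  ; components = λ a → ≅.sym (coerce-≅ D (eq₀ p a) (eq₀ q a) (η α a))
  })

-- `φ` lies over `f`, which is `f` after the identity, so it factors through the cartesian `φ′` over
-- the identity of `x`.
lift-comparison : ∀ {o h} {E B : Category o h} (p : Functor E B) {x y : Obj B} {f : B [ x , y ]}
                  {d d′ e : Obj E} {φ : E [ d , e ]} {φ′ : E [ d′ , e ]} →
                  IsCartesianLift p f φ → IsCartesianLift p f φ′ →
                  ∃ λ (m : E [ d , d′ ]) → E [ φ′ ∘ m ] ≡ φ × F₁ p m ≅ id[ B ] {x}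
lift-comparison {B = B} p {φ = φ} l l′ = factor p l′ id[ B ] φ (dom-over l)
  (≅.trans (over l) (≡-to-≅ (sym (Category.identityʳ B))))
  where open IsCartesianLift

-- Cancel the cartesian `φ′`: both sides become `φ′` after composing with it, and both lie over the
-- identity. Exchanging the two lifts gives the other inverse law.
lift-endo-id : ∀ {o h} {E B : Category o h} (p : Functor E B) {x y : Obj B} {f : B [ x , y ]}
               {d d′ e : Obj E} {φ : E [ d , e ]} {φ′ : E [ d′ , e ]} →
               IsCartesianLift p f φ → IsCartesianLift p f φ′ →
               {i : E [ d , d′ ]} {j : E [ d′ , d ]} →
               E [ φ′ ∘ i ] ≡ φ → E [ φ ∘ j ] ≡ φ′ →
               F₁ p i ≅ id[ B ] {x} → F₁ p j ≅ id[ B ] {x} →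
               E [ i ∘ j ] ≡ id[ E ]
lift-endo-id {E = E} {B} p l l′ {j = j} s t i≅ j≅ = factor-unique p l′
  (trans (sym (Category.assoc E))
  (trans (cong (λ g → E [ g ∘ j ]) s) (trans t (sym (Category.identityʳ E)))))
  (≅-to-≡ (≅.trans (≡-to-≅ (Functor.homomorphism p))
  (≅.trans (∘-cong≅ B (dom-over l′) (dom-over l) (dom-over l′) i≅ j≅)
  (≅.trans (≡-to-≅ (Category.identityˡ B))
  (≅.trans (id-cong≅ B (sym (dom-over l′)))
           (≡-to-≅ (sym (Functor.identity p))))))))
  where open IsCartesianLift

Σ-lift : ∀ {o h} (D : PlainDTT o h) → let open PlainDTT D in
         ∀ {x y} {f : ctx [ x , y ]} {d e} {φ : U̇ [ d , e ]} →
         IsCartesianLift u̇ f φ → IsCartesianLift u f (F₁ Σ φ)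
Σ-lift D {d = d} {e} {φ} l = record
  { dom-over  = trans (eq₀ uΣ≈u̇ d) (dom-over l)
  ; cod-over  = trans (eq₀ uΣ≈u̇ e) (cod-over l)
  ; over      = ≅.trans (eq₁ uΣ≈u̇ φ) (over l)
  ; cartesian = Σ-cartesian (cartesian l)
  }
  where
  open PlainDTT D
  open IsCartesianLift

module DependencyPolicies {o h} (D : PlainDTT o h) where
  open PlainDTT D
  open Dependency D
  open Generated D

  η′-policy : Policy η′
  η′-policy = whiskerˡ u̇-rule unit-policy

  δ-policy : Policy δ
  δ-policy = recast-policy theory _ _ (whiskerˡ u-rule counit-policy)

  u̇ΔΣ-rule : Rule (u̇ ∘F (Δ ∘F Σ))
  u̇ΔΣ-rule = u̇-rule ∘-rule (Δ-rule ∘-rule Σ-rule)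

  -- The source of `η′` is `u̇ ∘F idF`, already of the form required for lifting with `idF` as the
  -- lifted rule; `id-dom u̇-rule` puts that identity in the theory.
  u*η′-policy : Policy u*η′
  u*η′-policy = ♯-policy (id-dom u̇-rule) u̇ΔΣ-rule u̇-rule η′-policy u-rule u-cleavage

  u̇*η′-policy : Policy u̇*η′
  u̇*η′-policy = ♯-policy (id-dom u̇-rule) u̇ΔΣ-rule u̇-rule η′-policy u̇-rule u̇-cleavage

  u*id-rule : Rule u*id
  u*id-rule = ♯-rule (id-dom u̇-rule) u̇ΔΣ-rule u̇-rule η′-policy u-rule u-cleavage

  u̇*id-rule : Rule u̇*id
  u̇*id-rule = ♯-rule (id-dom u̇-rule) u̇ΔΣ-rule u̇-rule η′-policy u̇-rule u̇-cleavage

  DTy-policy : Policy DTy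
  DTy-policy = recast-policy theory _ _
    -- The inner recast rewrites the target `u ∘F π₂` along `square`, that is u(B) = u̇ΔΣ(a), so
    -- that `δ` at Σ(a) can follow.
    (whiskerʳ δ-policy (Σ-rule ∘-rule pullback-π₁ u̇ΔΣ-rule u-rule)
      ∘-policy recast-policy theory _ _ (whiskerˡ u-rule u*η′-policy))

  DTm-policy : Policy DTm
  DTm-policy = recast-policy theory _ _
    (whiskerʳ δ-policy (Σ-rule ∘-rule pullback-π₁ u̇ΔΣ-rule u̇-rule)
      ∘-policy recast-policy theory _ _ (whiskerˡ u̇-rule u̇*η′-policy))

module TermSubstitution {o h} (D : PlainDTT o h) where
  open PlainDTT D
  open Dependency D
  open CartesianLift

  Σ-tm-lift : ∀ {Γ a A b B} (⊢a : Γ ⊢ a ∶ A) (⊢b : ext A ⊢ b ∶ B) →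
              IsCartesianLift u (η η′ a) (F₁ Σ (mor (tm-lift ⊢a ⊢b)))
  Σ-tm-lift ⊢a ⊢b = Σ-lift D (isLift (tm-lift ⊢a ⊢b))

  Σ-[]-iso : ∀ {Γ a A b B} (⊢a : Γ ⊢ a ∶ A) (⊢b : ext A ⊢ b ∶ B) →
             let b[a] = ⊢b [ ⊢a ]ᵗᵐ
                 B[a] = ⊢-type ⊢b [ ⊢a ]ᵗʸ
             in ∃₂ λ (i : U [ F₀ Σ b[a] , B[a] ]) (j : U [ B[a] , F₀ Σ b[a] ]) →
                  U [ i ∘ j ] ≡ id[ U ]
                × U [ j ∘ i ] ≡ id[ U ]
                × F₁ u i ≅ id[ ctx ] {Γ}
                × U [ mor (ty-lift ⊢a (⊢-type ⊢b)) ∘ i ] ≅ F₁ Σ (mor (tm-lift ⊢a ⊢b))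
  -- The first `refl` makes Γ the base `F₀ u̇ a` over which the comparison is the identity; the
  -- second makes B equal to `F₀ Σ b`, so both lifts end at the same object.
  Σ-[]-iso ⊢a@(refl , _) ⊢b@(_ , refl) =
      i , j , lift-endo-id u l l′ i-comm j-comm i-over j-over
    , lift-endo-id u l′ l j-comm i-comm j-over i-over
    , i-over , ≡-to-≅ i-comm
    where
    l  = Σ-tm-lift ⊢a ⊢b
    l′ = isLift (ty-lift ⊢a (⊢-type ⊢b))
    to   = lift-comparison u l l′
    from = lift-comparison u l′ l
    i = proj₁ to
    j = proj₁ from
    i-comm = proj₁ (proj₂ to)
    j-comm = proj₁ (proj₂ from)
    i-over = proj₂ (proj₂ to)
    j-over = proj₂ (proj₂ from)

  Σ-[]-≡ : ∀ {Γ a A b B} (⊢a : Γ ⊢ a ∶ A) (⊢b : ext A ⊢ b ∶ B) → Σ-PreservesCleavage →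
           F₀ Σ (⊢b [ ⊢a ]ᵗᵐ) ≡ ⊢-type ⊢b [ ⊢a ]ᵗʸ
  Σ-[]-≡ {a = a} {b = b} ⊢a@(_ , refl) ⊢b@(_ , refl) preserves =
    -- The omitted codomain proofs are those passed to the two cleavages in the goal.
    proj₁ (preserves (η η′ a) b _ _)

mainTheorem7 :
  ∀ {o h} (D : PlainDTT o h) →
  let open PlainDTT D
      open Dependency D
      open JudgementalTheory (Generated.theory D)
      open CartesianLift using (mor)
  in
    -- the ♯-liftings of η′ along u and u̇ belong to the theory
    (Rule u*id × Policy u*η′ × Rule u̇*id × Policy u̇*η′)
    -- (DTy)
  × (∀ {Γ a A B} (⊢a : Γ ⊢ a ∶ A) (⊢B : ext A ⊢ B type) →
     let x    = ty-premise ⊢a ⊢B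
         B[a] = ⊢B [ ⊢a ]ᵗʸ
     in (Γ ⊢ B[a] type)
      × F₀ (π₁ ∘F u*id) x ≡ a
      × F₀ (π₂ ∘F u*id) x ≡ B[a]
      × η u*η′ x ≅ mor (ty-lift ⊢a ⊢B)
      × IsCartesianLift u (η η′ a) (η u*η′ x))
    -- (DTm)
  × (∀ {Γ a A b B} (⊢a : Γ ⊢ a ∶ A) (⊢b : ext A ⊢ b ∶ B) →
     let y    = tm-premise ⊢a ⊢b
         b[a] = ⊢b [ ⊢a ]ᵗᵐ
         ⊢B   = ⊢-type ⊢b
         B[a] = ⊢B [ ⊢a ]ᵗʸ
     in F₀ u̇ b[a] ≡ Γ
      × F₀ (π₁ ∘F u̇*id) y ≡ a
      × F₀ (π₂ ∘F u̇*id) y ≡ b[a]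
      × η u̇*η′ y ≅ mor (tm-lift ⊢a ⊢b)
      × IsCartesianLift u̇ (η η′ a) (η u̇*η′ y)
        -- typing: Σ (b[a]) is a reindexing of B = Σ b along η′ at a, hence
        -- isomorphic to B[a] over B and over the identity of Γ, and equal
        -- to B[a] when Σ preserves the cleavages
      × IsCartesianLift u (η η′ a) (F₁ Σ (η u̇*η′ y))
      × (∃₂ λ (i : U [ F₀ Σ b[a] , B[a] ]) (j : U [ B[a] , F₀ Σ b[a] ]) →
           U [ i ∘ j ] ≡ id[ U ]
         × U [ j ∘ i ] ≡ id[ U ]
         × F₁ u i ≅ id[ ctx ] {Γ}
         × U [ mor (ty-lift ⊢a ⊢B) ∘ i ] ≅ F₁ Σ (mor (tm-lift ⊢a ⊢b)))
      × (Σ-PreservesCleavage → Γ ⊢ b[a] ∶ B[a]))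
    -- the premises re-based over Γ
  × (Policy DTy × Policy DTm)
  × (∀ {Γ a A B} (⊢a : Γ ⊢ a ∶ A) (⊢B : ext A ⊢ B type) →
     let x = ty-premise ⊢a ⊢B
     in F₀ (v ∘F Σ·ΔU) x ≡ Γ × F₀ (proj-U̇×U ∘F u*id) x ≡ Γ)
  × (∀ {Γ a A b B} (⊢a : Γ ⊢ a ∶ A) (⊢b : ext A ⊢ b ∶ B) →
     let y = tm-premise ⊢a ⊢b
     in F₀ (v̇ ∘F Σ·ΔU̇) y ≡ Γ × F₀ (proj-U̇×U̇ ∘F u̇*id) y ≡ Γ)
mainTheorem7 D =
    (u*id-rule , u*η′-policy , u̇*id-rule , u̇*η′-policy)
  -- `ty-lift` is the very call of the cleavage made inside `u*id` and `u*η′`, so the projections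
  -- and the component hold by computation.
  , (λ ⊢a ⊢B → let l = ty-lift ⊢a ⊢B in
       trans (dom-over l) (proj₁ ⊢a) , refl , refl , ≅.refl , isLift l)
  , (λ ⊢a ⊢b → let l = tm-lift ⊢a ⊢b ; b[a]-over-Γ = trans (dom-over l) (proj₁ ⊢a) in
       b[a]-over-Γ , refl , refl , ≅.refl , isLift l , Σ-tm-lift ⊢a ⊢b , Σ-[]-iso ⊢a ⊢b
     , λ preserves → b[a]-over-Γ , Σ-[]-≡ ⊢a ⊢b preserves)
  , (DTy-policy , DTm-policy)
  -- After pasting with `δ` the premise sits over uΣ(a), which is u̇(a) by `uΣ≈u̇`; the conclusion
  -- sits over the domain of `η′` at a, again u̇(a).
  , (λ { ⊢a@(u̇a≡Γ , _) ⊢B →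
         trans (eq₀ uΣ≈u̇ _) u̇a≡Γ , trans (dom-over (ty-lift ⊢a ⊢B)) u̇a≡Γ })
  , (λ { ⊢a@(u̇a≡Γ , _) ⊢b →
         trans (eq₀ uΣ≈u̇ _) u̇a≡Γ , trans (dom-over (tm-lift ⊢a ⊢b)) u̇a≡Γ })
  where
  open PlainDTT D
  open Dependency D
  open DependencyPolicies D
  open TermSubstitution D
  open CartesianLift
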